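{- $N(63) \ge 8$; that is, there exist $8$ mutually orthogonal Latin squares of order $63$.
   Context: A Latin square of order $n$ on an $n$-element set $V$ is an $n\times n$ matrix every row and every column of which is a permutation of $V$. Two Latin squares $L_1=(v_{ij})$ and $L_2=(w_{ij})$ of order $n$ (on symbol sets $V$, $W$ of size $n$) are orthogonal if the $n^2$ pairs $(v_{ij},w_{ij})$ are all distinct, i.e. they exhaust $V\times W$. A set of Latin squares is a set of mutually orthogonal Latin squares (MOLS) if any two of them are orthogonal. $N(n)$ denotes the largest size of a set of MOLS of order $n$. -}

module Defs where

open import Data.Nat using (ℕ)
open import Data.Fin using (Fin)
open import Data.Product using (_×_; _,_; Σ)
open import Relation.Binary.PropositionalEquality using (_≡_; _≢_)
open import Function.Definitions using (Injective; Bijective)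

Square : ℕ → Set
Square n = Fin n → Fin n → Fin n

IsLatin : {n : ℕ} → Square n → Set
IsLatin {n} L =
  ((i : Fin n) → Bijective _≡_ _≡_ (λ j → L i j)) ×
  ((j : Fin n) → Bijective _≡_ _≡_ (λ i → L i j))

Orthogonal : {n : ℕ} → Square n → Square n → Set
Orthogonal {n} L₁ L₂ =
  Injective _≡_ _≡_ (λ (p : Fin n × Fin n) → let (i , j) = p in (L₁ i j , L₂ i j))

IsMOLS : (k n : ℕ) → (Fin k → Square n) → Set
IsMOLS k n L =
  ((a : Fin k) → IsLatin (L a)) ×
  ((a b : Fin k) → a ≢ b → Orthogonal (L a) (L b))

HasMOLS : (k n : ℕ) → Set
HasMOLS k n = Σ (Fin k → Square n) (IsMOLS k n)

{-# OPTIONS --safe #-}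

-- Let G be a group of order n and c a k × n matrix over G such that every row
-- c a and every quotient κ ↦ (c a κ)⁻¹ c b κ of two distinct rows is injective
-- (a difference matrix, normalised by an omitted row of identities).  Then the
-- squares x , κ ↦ x (c a κ) are orthogonal: if x , κ and y , μ carry the same
-- symbols in squares a and b, cancelling x and y leaves the quotients of rows
-- a and b equal at κ and μ, so κ = μ and then x = y.
--
-- For n = 63 take G = ℤ₇ ⋊ (ℤ₃ × ℤ₃), the first ℤ₃ acting on ℤ₇ by doubling.
-- The Sylow 3-subgroup ℤ₃ × ℤ₃ is identified with 𝔽₉ = 𝔽₃[i], and the squares
-- are indexed by the nonzero α ∈ 𝔽₉.  The columns are closed under multiplying
-- row α on the right by α p, for every p ∈ 𝔽₉: distinct elements of the Sylow
-- subgroup are not conjugate in G, so this acts freely on the quotients of any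
-- two rows, and 7 columns generate the matrix.

module Submission where

open import Defs
open import Agda.Builtin.FromNat using (Number; fromNat)
open import Algebra.Bundles using (Group)
import Algebra.Properties.Group as GroupProperties
open import Algebra.Structures using (IsGroup)
open import Data.Fin using (Fin; toℕ; punchOut)
import Data.Fin.Literals as FinLiterals
open import Data.Fin.Properties using (_≟_; all?; any?; *↔×; punchOut-injective; <⇒notInjective)
open import Data.Nat using (ℕ; zero; suc; _+_; _*_; _∸_; _^_)
open import Data.Nat.DivMod using (_mod_)
import Data.Nat.Literals as NatLiterals
open import Data.Nat.Properties using (n<1+n)
open import Data.Product using (_×_; _,_; ∃; proj₁; proj₂)
open import Data.Product.Function.NonDependent.Propositional using (_×-↔_)
open import Data.Product.Properties using (≡-dec; ,-injective)
open import Data.Sum using (_⊎_; fromInj₂)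
open import Data.Unit using (⊤)
open import Data.Vec using (Vec; []; _∷_; lookup; tabulate)
open import Data.Vec.Properties using (lookup∘tabulate)
open import Data.Vec.Relation.Unary.AllPairs using (allPairs?)
open import Data.Vec.Relation.Unary.Unique.Propositional using (Unique)
open import Data.Vec.Relation.Unary.Unique.Propositional.Properties using (lookup-injective)
open import Function using (_↔_; Inverse; Injection; Injective; Bijective)
open import Function.Construct.Composition using (_↔-∘_)
open import Function.Construct.Identity using (↔-id)
open import Function.Properties.Inverse using (↔-sym; ↔⇒↣)
open import Level using (0ℓ)
open import Relation.Binary.PropositionalEquality using (_≡_; _≢_; refl; sym; trans; cong; cong₂; isEquivalence; module ≡-Reasoning)
open import Relation.Nullary using (Dec; yes; no; contradiction)
open import Relation.Nullary.Decidable using (¬?; _⊎-dec_; map′; from-yes)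
open import Relation.Unary using (Pred; Decidable)

instance
  ℕ-literals : Number ℕ
  ℕ-literals = NatLiterals.number

  Fin-literals : ∀ {n} → Number (Fin n)
  Fin-literals = FinLiterals.number _

-- Pigeonhole: if `y` were missed, `punchOut` at `y` would inject `Fin (suc n)` into `Fin n`.
injective⇒bijective : ∀ {n} {f : Fin n → Fin n} →
                      Injective _≡_ _≡_ f → Bijective _≡_ _≡_ f
injective⇒bijective {zero}      f-injective = f-injective , λ ()
injective⇒bijective {suc n} {f} f-injective =
  f-injective , λ y → let x , fx≡y = preimage y in x , λ { refl → fx≡y }
  where
  preimage : ∀ y → ∃ λ x → f x ≡ y
  preimage y with any? (λ x → f x ≟ y)
  ... | yes found  = found
  ... | no  missed = contradiction
    (λ {x} {x′} eq → f-injective (punchOut-injective (y≢f x) (y≢f x′) eq))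
    (<⇒notInjective (n<1+n n))
    where
    y≢f : ∀ x → y ≢ f x
    y≢f x y≡fx = missed (x , sym y≡fx)

-- Reduces injectivity to pairwise distinctness in a finite table, which evaluation can decide.
unique-tabulate⇒injective : ∀ {n} {A : Set} {f : Fin n → A} →
                            Unique (tabulate f) → Injective _≡_ _≡_ f
unique-tabulate⇒injective {f = f} unique {i} {j} fi≡fj = lookup-injective unique i j
  (trans (lookup∘tabulate f i) (trans fi≡fj (sym (lookup∘tabulate f j))))

module _ {A : Set} {_∙_ : A → A → A} {ε : A} {_⁻¹ : A → A}
         (isGroup : IsGroup _≡_ _∙_ ε _⁻¹) where

  private
    group : Group 0ℓ 0ℓ
    group = record { isGroup = isGroup }

  open Group group using (assoc; _\\_)
  open GroupProperties group using (∙-cancelˡ; ∙-cancelʳ; \\-leftDividesʳ; ⁻¹-anti-homo-∙)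

  -- Inverting `x ∙ u` reverses the factors, so the two `x` meet and cancel; this frees a quotient
  -- of two symbols from the row of the squares.
  \\-translate : ∀ x u v → (x ∙ u) \\ (x ∙ v) ≡ u \\ v
  \\-translate x u v = begin
    ((x ∙ u) ⁻¹) ∙ (x ∙ v)         ≡⟨ cong (_∙ (x ∙ v)) (⁻¹-anti-homo-∙ x u) ⟩
    ((u ⁻¹) ∙ (x ⁻¹)) ∙ (x ∙ v)    ≡⟨ assoc (u ⁻¹) (x ⁻¹) (x ∙ v) ⟩
    (u ⁻¹) ∙ ((x ⁻¹) ∙ (x ∙ v))    ≡⟨ cong ((u ⁻¹) ∙_) (\\-leftDividesʳ x v) ⟩
    (u ⁻¹) ∙ v                     ∎
    where open ≡-Reasoning

  differenceMatrix⇒MOLS : ∀ {k n} → Fin n ↔ A → (c : Fin k → Fin n → A) →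
    (∀ a → Injective _≡_ _≡_ (c a)) →
    (∀ a b → a ≢ b → Injective _≡_ _≡_ (λ κ → (c a κ ⁻¹) ∙ c b κ)) →
    HasMOLS k n
  differenceMatrix⇒MOLS {k} {n} e c row-injective quotient-injective =
    L , latin , orthogonal
    where
    open Inverse e using (to; from)
    open Injection (↔⇒↣ e) using (injective)
    open Injection (↔⇒↣ (↔-sym e)) using () renaming (injective to from-injective)

    L : Fin k → Square n
    L a x κ = from (to x ∙ c a κ)

    latin : ∀ a → IsLatin (L a)
    latin a =
      (λ x → injective⇒bijective λ {κ} {μ} eq →
        row-injective a (∙-cancelˡ (to x) (c a κ) (c a μ) (from-injective eq))) ,
      (λ κ → injective⇒bijective λ {x} {y} eq →
        injective (∙-cancelʳ (c a κ) (to x) (to y) (from-injective eq)))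

    orthogonal : ∀ a b → a ≢ b → Orthogonal (L a) (L b)
    orthogonal a b a≢b {x , κ} {y , μ} eq = cong₂ _,_ x≡y κ≡μ
      where
      open ≡-Reasoning

      eqᵃ : to x ∙ c a κ ≡ to y ∙ c a μ
      eqᵃ = from-injective (proj₁ (,-injective eq))

      eqᵇ : to x ∙ c b κ ≡ to y ∙ c b μ
      eqᵇ = from-injective (proj₂ (,-injective eq))

      κ≡μ : κ ≡ μ
      κ≡μ = quotient-injective a b a≢b (begin
        c a κ \\ c b κ                      ≡⟨ \\-translate (to x) (c a κ) (c b κ) ⟨
        (to x ∙ c a κ) \\ (to x ∙ c b κ)    ≡⟨ cong₂ _\\_ eqᵃ eqᵇ ⟩
        (to y ∙ c a μ) \\ (to y ∙ c b μ)    ≡⟨ \\-translate (to y) (c a μ) (c b μ) ⟩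
        c a μ \\ c b μ                      ∎)

      x≡y : x ≡ y
      x≡y = injective (∙-cancelʳ (c a κ) (to x) (to y)
        (trans eqᵃ (cong (λ ν → to y ∙ c a ν) (sym κ≡μ))))

infixl 6 _+₃_ _+₇_
infixl 7 _*₃_ _▷_ _·_ _∙_
infix  8 -₃_ -₇_ _⁻¹

_+₃_ _*₃_ : Fin 3 → Fin 3 → Fin 3
s +₃ t = (toℕ s + toℕ t) mod 3
s *₃ t = (toℕ s * toℕ t) mod 3

-₃_ : Fin 3 → Fin 3
-₃ s = (3 ∸ toℕ s) mod 3

_+₇_ : Fin 7 → Fin 7 → Fin 7
x +₇ y = (toℕ x + toℕ y) mod 7

-₇_ : Fin 7 → Fin 7
-₇ x = (7 ∸ toℕ x) mod 7

-- As 2 has order 3 modulo 7, the exponent matters only modulo 3 and this is an action of ℤ₃.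
_▷_ : Fin 3 → Fin 7 → Fin 7
s ▷ x = (2 ^ toℕ s * toℕ x) mod 7

𝔽₉ G : Set
𝔽₉ = Fin 3 × Fin 3
G  = Fin 7 × 𝔽₉

-- Multiplication in 𝔽₃[i] with i² = -1, where `(a , b)` stands for a + bi.
_·_ : 𝔽₉ → 𝔽₉ → 𝔽₉
(a , b) · (p , q) = a *₃ p +₃ -₃ (b *₃ q) , a *₃ q +₃ b *₃ p

_∙_ : G → G → G
(x , s , t) ∙ (y , s′ , t′) = x +₇ s ▷ y , s +₃ s′ , t +₃ t′

_⁻¹ : G → G
(x , s , t) ⁻¹ = (-₃ s) ▷ (-₇ x) , -₃ s , -₃ t

ε : G
ε = 0 , 0 , 0

allG? : {P : Pred G 0ℓ} → Decidable P → Dec (∀ g → P g)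
allG? P? = map′ (λ h (x , s , t) → h x s t) (λ h x s t → h (x , s , t))
  (all? λ x → all? λ s → all? λ t → P? (x , s , t))

_≟ᴳ_ : (g h : G) → Dec (g ≡ h)
_≟ᴳ_ = ≡-dec _≟_ (≡-dec _≟_ _≟_)

+₃-assoc : ∀ s t u → (s +₃ t) +₃ u ≡ s +₃ (t +₃ u)
+₃-assoc = from-yes (all? λ s → all? λ t → all? λ u → (s +₃ t) +₃ u ≟ s +₃ (t +₃ u))

-- The ℤ₇ coordinate of associativity in `G`: treated alone, it takes 3² · 7³ cases instead of 63³.
+₇-▷-assoc : ∀ s t x y z → (x +₇ s ▷ y) +₇ (s +₃ t) ▷ z ≡ x +₇ s ▷ (y +₇ t ▷ z)
+₇-▷-assoc = from-yes (all? λ s → all? λ t → all? λ x → all? λ y → all? λ z →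
  (x +₇ s ▷ y) +₇ (s +₃ t) ▷ z ≟ x +₇ s ▷ (y +₇ t ▷ z))

G-isGroup : IsGroup _≡_ _∙_ ε _⁻¹
G-isGroup = record
  { isMonoid = record
    { isSemigroup = record
      { isMagma = record { isEquivalence = isEquivalence ; ∙-cong = cong₂ _∙_ }
      ; assoc = λ (x , s , t) (y , s′ , t′) (z , s″ , t″) →
          cong₂ _,_ (+₇-▷-assoc s s′ x y z) (cong₂ _,_ (+₃-assoc s s′ s″) (+₃-assoc t t′ t″))
      }
    ; identity = from-yes (allG? λ g → (ε ∙ g) ≟ᴳ g) , from-yes (allG? λ g → (g ∙ ε) ≟ᴳ g)
    }
  ; inverse = from-yes (allG? λ g → (g ⁻¹ ∙ g) ≟ᴳ ε) , from-yes (allG? λ g → (g ∙ g ⁻¹) ≟ᴳ ε)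
  ; ⁻¹-cong = cong _⁻¹
  }

-- Serves twice: it numbers the elements of `G`, and it splits a column index into a generating
-- column and some `p` in `𝔽₉`.
Fin63↔G : Fin 63 ↔ G
Fin63↔G = (↔-id _ ×-↔ *↔×) ↔-∘ *↔×

-- Each α ∈ 𝔽₉ ∖ {0} with the entries of row α in the 7 generating columns,
-- found by computer.
generators : Vec (𝔽₉ × Vec G 7) 8
generators =
  ((0 , 1) , (5 , 2 , 1) ∷ (2 , 0 , 1) ∷ (1 , 0 , 2) ∷ (3 , 2 , 1) ∷ (6 , 0 , 0) ∷ (4 , 1 , 1) ∷ (0 , 0 , 0) ∷ []) ∷
  ((0 , 2) , (3 , 1 , 1) ∷ (6 , 0 , 1) ∷ (4 , 0 , 0) ∷ (2 , 1 , 2) ∷ (1 , 2 , 1) ∷ (5 , 0 , 0) ∷ (0 , 0 , 0) ∷ []) ∷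
  ((1 , 0) , (0 , 0 , 0) ∷ (1 , 0 , 0) ∷ (2 , 0 , 0) ∷ (3 , 0 , 0) ∷ (4 , 0 , 0) ∷ (5 , 0 , 0) ∷ (6 , 0 , 0) ∷ []) ∷
  ((1 , 1) , (4 , 1 , 0) ∷ (5 , 1 , 2) ∷ (2 , 2 , 2) ∷ (6 , 1 , 1) ∷ (3 , 0 , 1) ∷ (1 , 0 , 0) ∷ (0 , 0 , 0) ∷ []) ∷
  ((1 , 2) , (0 , 1 , 1) ∷ (2 , 1 , 1) ∷ (4 , 1 , 0) ∷ (1 , 0 , 0) ∷ (3 , 1 , 1) ∷ (6 , 2 , 0) ∷ (5 , 0 , 0) ∷ []) ∷
  ((2 , 0) , (5 , 2 , 0) ∷ (3 , 1 , 0) ∷ (4 , 0 , 0) ∷ (0 , 1 , 0) ∷ (2 , 0 , 0) ∷ (1 , 0 , 0) ∷ (6 , 0 , 0) ∷ []) ∷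
  ((2 , 1) , (4 , 0 , 1) ∷ (3 , 0 , 1) ∷ (0 , 0 , 1) ∷ (1 , 1 , 2) ∷ (6 , 2 , 0) ∷ (5 , 2 , 1) ∷ (2 , 0 , 0) ∷ []) ∷
  ((2 , 2) , (3 , 2 , 1) ∷ (5 , 1 , 1) ∷ (1 , 0 , 0) ∷ (0 , 2 , 1) ∷ (4 , 2 , 2) ∷ (6 , 0 , 0) ∷ (2 , 0 , 0) ∷ []) ∷ []

matrix : Fin 8 → Fin 63 → G
matrix a κ with (k , p) ← Inverse.to Fin63↔G κ | α , row ← lookup generators a =
  lookup row k ∙ (0 , α · p)

unique? : ∀ {n} (gs : Vec G n) → Dec (Unique gs)
unique? = allPairs? λ g h → ¬? (g ≟ᴳ h)

-- The seven generating entries of a row differ in their ℤ₇ coordinates, which right multiplication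
-- by `(0 , α · p)` preserves; the 𝔽₉ coordinate moves by `α · p`, with α ≠ 0.
rows-unique : ∀ a → Unique (tabulate (matrix a))
rows-unique = from-yes (all? λ a → unique? (tabulate (matrix a)))

-- The case `a ≡ b` is set apart because every quotient is then `ε`.
quotients-unique : ∀ a b → a ≡ b ⊎ Unique (tabulate λ κ → matrix a κ ⁻¹ ∙ matrix b κ)
quotients-unique = from-yes (all? λ a → all? λ b →
  (a ≟ b) ⊎-dec unique? (tabulate λ κ → matrix a κ ⁻¹ ∙ matrix b κ))

theorem4 : HasMOLS 8 63
theorem4 = differenceMatrix⇒MOLS G-isGroup Fin63↔G matrix
  (λ a → unique-tabulate⇒injective (rows-unique a))
  (λ a b a≢b → unique-tabulate⇒injective
    (fromInj₂ (λ a≡b → contradiction a≡b a≢b) (quotients-unique a b)))
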